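{- For $n\ge 0$, $$\left|\mathcal{S}^2_n(213)\right|=\left|\mathcal{S}^2_n(312)\right|=\frac{1}{3n+1}\sum_{v=0}^{n}\binom{3n+1}{n-v}\binom{3n+v}{v}.$$
   Context: $\mathcal{S}^2_n(P)$ denotes the set of permutations $\pi\in\mathcal{S}_{3n}$ that avoid every pattern in $P$ (classical pattern avoidance) and satisfy $\pi_{3i+1}<\pi_{3i+2}$ and $\pi_{3i+1}<\pi_{3i+3}$ for all $0\le i<n$. -}

module Defs where

open import Data.Nat using (ℕ; zero; suc; _+_; _*_; _<_; _∸_)
open import Data.Nat.Combinatorics using (_C_)
open import Data.Fin using (Fin; toℕ)
open import Data.Vec using (Vec; lookup)
open import Data.List using (List; length; map; upTo)
open import Data.Nat.ListAction using (sum)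
open import Data.List.Membership.Propositional using (_∈_)
open import Data.List.Relation.Unary.Unique.Propositional using (Unique)
open import Data.Product using (∃; ∃-syntax; _×_)
open import Relation.Nullary using (¬_)
open import Relation.Binary.PropositionalEquality using (_≡_)
open import Function.Bundles using (_⇔_)

IsPerm : {m : ℕ} → Vec (Fin m) m → Set
IsPerm {m} π = (i j : Fin m) → lookup π i ≡ lookup π j → i ≡ j

val : {m : ℕ} → Vec (Fin m) m → Fin m → ℕ
val π i = toℕ (lookup π i)

Contains213 : {m : ℕ} → Vec (Fin m) m → Set
Contains213 {m} π = ∃[ i ] ∃[ j ] ∃[ k ]
  (toℕ i < toℕ j × toℕ j < toℕ k × val π j < val π i × val π i < val π k)

Contains312 : {m : ℕ} → Vec (Fin m) m → Set
Contains312 {m} π = ∃[ i ] ∃[ j ] ∃[ k ]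
  (toℕ i < toℕ j × toℕ j < toℕ k × val π j < val π k × val π k < val π i)

-- Block condition: for each block of three consecutive positions
-- 3i+1,3i+2,3i+3 (1-indexed), i.e. 3i,3i+1,3i+2 (0-indexed),
-- the first entry is smaller than the other two.
BlockCond : (n : ℕ) → Vec (Fin (3 * n)) (3 * n) → Set
BlockCond n π = (i : ℕ) (p q r : Fin (3 * n)) →
  toℕ p ≡ 3 * i → toℕ q ≡ 3 * i + 1 → toℕ r ≡ 3 * i + 2 →
  val π p < val π q × val π p < val π r

InS2 : (n : ℕ) → (Vec (Fin (3 * n)) (3 * n) → Set) → Vec (Fin (3 * n)) (3 * n) → Set
InS2 n Contains π = IsPerm π × ¬ Contains π × BlockCond n π

HasCard : {A : Set} → (A → Set) → ℕ → Set
HasCard {A} P k = ∃[ xs ] (Unique xs × ((x : A) → (x ∈ xs ⇔ P x)) × length xs ≡ k)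

binomSum : ℕ → ℕ
binomSum n = sum (map (λ v → ((3 * n + 1) C (n ∸ v)) * ((3 * n + v) C v)) (upTo (suc n)))

-- "|S| = binomSum n / (3n+1)" expressed division-free: (3n+1)·|S| = binomSum n
HasCardFormula : {A : Set} → (A → Set) → ℕ → Set
HasCardFormula P n = ∃[ k ] (HasCard P k × (3 * n + 1) * k ≡ binomSum n)

{-# OPTIONS --safe #-}

-- Lehmer codes turn 312-avoidance into the local condition that an entry exceeds its right
-- neighbour by at most one, and the block condition into a condition on triples of code
-- entries; 213 is handled by reversal.
-- With D = 1 - 1/B, where B = 1 + xB³ + xB⁴, the codes for 312 with first entry at least s are
-- counted by Dˢ⁺¹B, and those for 213 whose last entry is at most h by Bʰ⁺¹; both families
-- satisfy the recursion obtained by expanding B. Lagrange inversion for B = φ(xB³),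
-- φ = (1 + t)/(1 - t), is then an identity between Delannoy numbers.
module Submission where

open import Defs
open import Data.Empty using (⊥; ⊥-elim)
open import Data.Fin using (Fin; zero; suc; toℕ; fromℕ<; punchIn; punchOut; opposite)
open import Data.Fin.Properties using (_≟_; toℕ<n; toℕ-injective; toℕ-fromℕ<; suc-injective;
  punchIn-injective; punchIn-mono-≤; punchIn-cancel-≤; punchInᵢ≢i; punchIn-punchOut;
  punchOut-injective; opposite-prop; opposite-involutive)
open import Data.List using (List; []; _∷_; _++_; _∷ʳ_; length; applyUpTo)
open import Data.List.Membership.Propositional using (_∈_)
open import Data.List.Membership.Propositional.Properties using (∈-++⁺ˡ; ∈-++⁺ʳ; ∈-++⁻)
open import Data.List.Properties using (map-applyUpTo; length-++; ∷-injective; ∷ʳ-injective)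
import Data.List.Relation.Unary.All as All
open import Data.List.Relation.Unary.All using ([])
open import Data.List.Relation.Unary.AllPairs using ([]; _∷_)
open import Data.List.Relation.Unary.Any using (here; there)
open import Data.List.Relation.Unary.Unique.Propositional using (Unique)
import Data.List.Relation.Unary.Unique.Propositional.Properties as Unique
open import Data.Nat hiding (_≟_)
open import Data.Nat.Combinatorics using (_C_; nCn≡1; nCk+nC[k+1]≡[n+1]C[k+1])
open import Data.Nat.ListAction using (sum)
open import Data.Nat.Properties hiding (suc-injective; _≟_)
open import Data.Nat.Tactic.RingSolver using (solve-∀)
open import Data.Product using (∃-syntax; _×_; _,_; proj₁; proj₂)
import Data.Sum as Sum
open import Data.Sum using (_⊎_; inj₁; inj₂; [_,_]′)
open import Data.Vec using (Vec; lookup; tabulate)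
open import Data.Vec.Properties using (lookup∘tabulate; tabulate∘lookup; tabulate-cong)
open import Function using (_∘_; id)
open import Function.Bundles using (_⇔_; mk⇔; Equivalence)
open import Relation.Binary.PropositionalEquality
open import Relation.Nullary using (¬_; yes; no; contradiction)

open import Algebra.Properties.CommutativeSemigroup +-commutativeSemigroup
  using () renaming (interchange to +-interchange)
open Equivalence using (to; from)

-- Blocks interact only at their borders, so a count refined by one border entry satisfies a closed
-- recursion. The equation for B is forced by the guess that codes for 312 with first entry exactly
-- s are counted by Dˢ⁺¹, for some D without constant term. Put B = 1 / (1 - D), so that summing
-- over all exponents from s on multiplies by B. The code behind a block with last entry t
-- contributes Dᵗ B; summing over t ≥ s gives Dˢ B², and a further free entry between s and t gives
-- Dˢ B³. Hence Dˢ⁺¹ = x (Dˢ B² + Dˢ B³), that is, B = 1 + B D = 1 + x B³ + x B⁴. In a code for 213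
-- the last entry of a block determines the block up to a binary choice, so these codes are taken
-- apart from the right, and their recursion is the same equation multiplied by Bʰ.

private variable
  A B : Set
  P Q : A → Set
  k l m n : ℕ
  Block : ℕ → ℕ → ℕ → Set

-- Powers of B and Delannoy numbers: Lagrange inversion.

-- The coefficient [xⁿ] Bʳ, where B = 1 + x B³ + x B⁴.
coefB : ℕ → ℕ → ℕ
coefB zero    r       = 1
coefB (suc n) zero    = 0
coefB (suc n) (suc r) = coefB (suc n) r + (coefB n (3 + r) + coefB n (4 + r))

-- The Delannoy number [tⁿ] ((1 + t) / (1 - t))ᵐ.
delannoy : ℕ → ℕ → ℕ
delannoy zero    m       = 1
delannoy (suc n) zero    = 0
delannoy (suc n) (suc m) = delannoy n (suc m) + delannoy (suc n) m + delannoy n m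

-- The differential equation (1 + t) (φᵐ)′ = m (φᵐ + φᵐ⁺¹) of φ = (1 + t) / (1 - t).
delannoy-derivative : ∀ n m →
  suc n * delannoy (suc n) m + n * delannoy n m ≡ m * delannoy n m + m * delannoy n (suc m)
delannoy-derivative zero zero = refl
delannoy-derivative (suc n) zero = cong₂ _+_ (*-zeroʳ n) (*-zeroʳ n)
delannoy-derivative zero (suc m) =
  trans (step (delannoy 1 m)) (trans (cong (2 +_) (delannoy-derivative zero m)) (collect m))
  where
  step : ∀ x → 1 * (1 + x + 1) + 0 * 1 ≡ 2 + (1 * x + 0 * 1)
  step = solve-∀
  collect : ∀ m → 2 + (m * 1 + m * 1) ≡ suc m * 1 + suc m * 1
  collect = solve-∀
delannoy-derivative (suc n) (suc m) = begin
  -- The recursion of `delannoy` splits the equation into three smaller instances; the shifted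
  -- factors n leave over `2 * delannoy (suc n) (suc m)`.
  _ ≡⟨ expandˡ n m (delannoy n m) (delannoy (suc n) m) (delannoy (2 + n) m) (delannoy n (suc m)) ⟩
  _ ≡⟨ cong₂ (λ u v → u + v + 2 * delannoy (suc n) (suc m))
         (cong₂ _+_ (delannoy-derivative n (suc m)) (delannoy-derivative (suc n) m))
         (delannoy-derivative n m) ⟩
  _ ≡⟨ expandʳ m (delannoy n m) (delannoy (suc n) m) (delannoy n (suc m)) (delannoy n (2 + m)) ⟩
  _ ∎
  where
  open ≡-Reasoning
  expandˡ : ∀ n m a b c d →
    (2 + n) * (d + b + a + c + b) + suc n * (d + b + a) ≡
    (suc n * (d + b + a) + n * d) + ((2 + n) * c + suc n * b) + (suc n * b + n * a) + 2 * (d + b + a)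
  expandˡ = solve-∀
  expandʳ : ∀ m a b d e →
    (suc m * d + suc m * e) + (m * b + m * (d + b + a)) + (m * a + m * d) + 2 * (d + b + a) ≡
    suc m * (d + b + a) + suc m * (e + (d + b + a) + d)
  expandʳ = solve-∀

-- Lagrange inversion for B = φ(x B³).
coefB-delannoy : ∀ n r → (3 * n + r) * coefB n r ≡ r * delannoy n (3 * n + r)
coefB-delannoy zero r = refl
coefB-delannoy (suc n) zero = *-zeroʳ (3 * suc n + 0)
-- The three terms of the recursion have the denominators `M`, `M` and `suc M`, which explains the
-- factor `M`. Adding `3 * n * Y` to both sides makes the derivative equation applicable without
-- subtraction.
coefB-delannoy (suc n) (suc r) = *-cancelˡ-≡ _ _ M (+-cancelʳ-≡ (3 * n * Y) _ _ (begin
    M * ((3 * suc n + suc r) * coefB (suc n) (suc r)) + 3 * n * Y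
      ≡⟨ cong (_+ 3 * n * Y) (distribute n r (coefB (suc n) r) (coefB n (3 + r)) (coefB n (4 + r))) ⟩
    suc M * (M * coefB (suc n) r)
      + (suc M * ((3 * n + (3 + r)) * coefB n (3 + r)) + M * ((3 * n + (4 + r)) * coefB n (4 + r)))
      + 3 * n * Y
      ≡⟨ cong (_+ 3 * n * Y) (cong₂ _+_ (cong (suc M *_) (coefB-delannoy (suc n) r))
           (cong₂ _+_
             (cong (suc M *_) (trans (coefB-delannoy n (3 + r))
               (cong (λ k → (3 + r) * delannoy n k) (shift₃ n r))))
             (cong (M *_) (trans (coefB-delannoy n (4 + r))
               (cong (λ k → (4 + r) * delannoy n k) (shift₄ n r)))))) ⟩
    suc M * (r * X) + (suc M * ((3 + r) * Y) + M * ((4 + r) * Z)) + 3 * n * Y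
      ≡⟨ collect₁ n r X Y Z ⟩
    rest n r X Y Z + 3 * (M * Y + M * Z)
      -- This trades Y and Z for `3 * suc n * X`, which together with `r * X` makes `M * X`.
      ≡⟨ cong (λ k → rest n r X Y Z + 3 * k) (sym (delannoy-derivative n M)) ⟩
    rest n r X Y Z + 3 * (suc n * X + n * Y)
      ≡⟨ collect₂ n r X Y Z ⟩
    M * (suc r * (Z + X + Y)) + 3 * n * Y
      ≡⟨ cong (λ k → M * (suc r * delannoy (suc n) k) + 3 * n * Y) (+-suc (3 * suc n) r) ⟨
    M * (suc r * delannoy (suc n) (3 * suc n + suc r)) + 3 * n * Y ∎))
  where
  open ≡-Reasoning
  M = 3 * suc n + r
  X = delannoy (suc n) M
  Y = delannoy n M
  Z = delannoy n (suc M)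
  rest : ℕ → ℕ → ℕ → ℕ → ℕ → ℕ
  rest n r X Y Z = (3 * suc n + r) * r * X + r * X + (3 * suc n + r) * suc r * (Y + Z)
  distribute : ∀ n r a b c → (3 * suc n + r) * ((3 * suc n + suc r) * (a + (b + c))) ≡
    suc (3 * suc n + r) * ((3 * suc n + r) * a)
      + (suc (3 * suc n + r) * ((3 * n + (3 + r)) * b) + (3 * suc n + r) * ((3 * n + (4 + r)) * c))
  distribute = solve-∀
  shift₃ : ∀ n r → 3 * n + (3 + r) ≡ 3 * suc n + r
  shift₃ = solve-∀
  shift₄ : ∀ n r → 3 * n + (4 + r) ≡ suc (3 * suc n + r)
  shift₄ = solve-∀
  collect₁ : ∀ n r X Y Z →
    suc (3 * suc n + r) * (r * X)
      + (suc (3 * suc n + r) * ((3 + r) * Y) + (3 * suc n + r) * ((4 + r) * Z)) + 3 * n * Y ≡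
    (3 * suc n + r) * r * X + r * X + (3 * suc n + r) * suc r * (Y + Z)
      + 3 * ((3 * suc n + r) * Y + (3 * suc n + r) * Z)
  collect₁ = solve-∀
  collect₂ : ∀ n r X Y Z →
    (3 * suc n + r) * r * X + r * X + (3 * suc n + r) * suc r * (Y + Z) + 3 * (suc n * X + n * Y) ≡
    (3 * suc n + r) * (suc r * (Z + X + Y)) + 3 * n * Y
  collect₂ = solve-∀

-- Delannoy numbers as convolutions of binomial coefficients.

-- The Cauchy product without `∸`: shifting `g` instead makes the product rules below plain
-- inductions.
convolve : (ℕ → ℕ) → (ℕ → ℕ) → ℕ → ℕ
convolve f g zero    = f 0 * g 0
convolve f g (suc n) = f (suc n) * g 0 + convolve f (g ∘ suc) n

sum-convolve : ∀ f g n → sum (applyUpTo (λ v → f (n ∸ v) * g v) (suc n)) ≡ convolve f g n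
sum-convolve f g zero    = +-identityʳ _
sum-convolve f g (suc n) = cong (f (suc n) * g 0 +_) (sum-convolve f (g ∘ suc) n)

convolve-congʳ : ∀ f {g h} → (∀ v → g v ≡ h v) → ∀ n → convolve f g n ≡ convolve f h n
convolve-congʳ f eq zero    = cong (f 0 *_) (eq 0)
convolve-congʳ f eq (suc n) =
  cong₂ (λ a b → f (suc n) * a + b) (eq 0) (convolve-congʳ f (eq ∘ suc) n)

convolve-+ʳ : ∀ f g h n → convolve f (λ v → g v + h v) n ≡ convolve f g n + convolve f h n
convolve-+ʳ f g h zero    = *-distribˡ-+ (f 0) (g 0) (h 0)
convolve-+ʳ f g h (suc n) =
  trans (cong (f (suc n) * (g 0 + h 0) +_) (convolve-+ʳ f (g ∘ suc) (h ∘ suc) n))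
        (regroup (f (suc n)) (g 0) (h 0) _ _)
  where
  regroup : ∀ a b c d e → a * (b + c) + (d + e) ≡ (a * b + d) + (a * c + e)
  regroup = solve-∀

-- As power series, `f′` is (1 + t) `f`.
convolve-pascalˡ : ∀ f f′ g → f′ 0 ≡ f 0 → (∀ k → f′ (suc k) ≡ f k + f (suc k)) →
  ∀ n → convolve f′ g (suc n) ≡ convolve f g (suc n) + convolve f g n
convolve-pascalˡ f f′ g f′0 f′s zero
  rewrite f′0 | f′s 0 = regroup (f 0) (f 1) (g 0) (g 1)
  where
  regroup : ∀ a b c d → (a + b) * c + a * d ≡ (b * c + a * d) + a * c
  regroup = solve-∀
convolve-pascalˡ f f′ g f′0 f′s (suc n) =
  trans (cong₂ (λ a b → a * g 0 + b) (f′s (suc n)) (convolve-pascalˡ f f′ (g ∘ suc) f′0 f′s n))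
        (regroup (f (suc n)) (f (2 + n)) (g 0) _ _)
  where
  regroup : ∀ a b c d e → (a + b) * c + (d + e) ≡ (b * c + d) + (a * c + e)
  regroup = solve-∀

-- As power series, `g` is (1 - t) `g′`.
convolve-pascalʳ : ∀ f g g′ → g′ 0 ≡ g 0 → (∀ v → g′ (suc v) ≡ g (suc v) + g′ v) →
  ∀ n → convolve f g′ (suc n) ≡ convolve f g (suc n) + convolve f g′ n
convolve-pascalʳ f g g′ g′0 g′s n = begin
  f (suc n) * g′ 0 + convolve f (g′ ∘ suc) n
    ≡⟨ cong₂ (λ a b → f (suc n) * a + b) g′0
         (trans (convolve-congʳ f g′s n) (convolve-+ʳ f (g ∘ suc) g′ n)) ⟩
  f (suc n) * g 0 + (convolve f (g ∘ suc) n + convolve f g′ n)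
    ≡⟨ +-assoc (f (suc n) * g 0) _ _ ⟨
  f (suc n) * g 0 + convolve f (g ∘ suc) n + convolve f g′ n ∎
  where open ≡-Reasoning

-- The coefficient [tᵛ] (1 - t)⁻ᵐ.
multichoose : ℕ → ℕ → ℕ
multichoose zero    zero    = 1
multichoose zero    (suc v) = 0
multichoose (suc m) v       = (m + v) C v

multichoose-zero : ∀ m → multichoose m 0 ≡ 1
multichoose-zero zero    = refl
multichoose-zero (suc m) = refl

multichoose-pascal : ∀ m v →
  multichoose (suc m) (suc v) ≡ multichoose m (suc v) + multichoose (suc m) v
multichoose-pascal zero    v = trans (nCn≡1 (suc v)) (sym (nCn≡1 v))
multichoose-pascal (suc m) v = begin
  (suc m + suc v) C suc v                      ≡⟨ nCk+nC[k+1]≡[n+1]C[k+1] (m + suc v) v ⟨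
  (m + suc v) C v + (m + suc v) C suc v        ≡⟨ +-comm ((m + suc v) C v) _ ⟩
  (m + suc v) C suc v + (m + suc v) C v        ≡⟨ cong (λ k → (m + suc v) C suc v + k C v) (+-suc m v) ⟩
  (m + suc v) C suc v + suc (m + v) C v        ∎
  where open ≡-Reasoning

-- The product of (1 + t)ᵐ and (1 - t)⁻ᵐ is φᵐ. Splitting off one factor 1 / (1 - t) and then one
-- factor 1 + t yields the recursion of `delannoy`.
convolve-delannoy : ∀ n m → convolve (m C_) (multichoose m) n ≡ delannoy n m
convolve-delannoy zero    m       = trans (+-identityʳ _) (multichoose-zero m)
convolve-delannoy (suc n) zero    = vanishes n
  where
  vanishes : ∀ n → convolve (0 C_) (λ _ → 0) n ≡ 0
  vanishes zero    = refl
  vanishes (suc n) = vanishes n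
convolve-delannoy (suc n) (suc m) = begin
  convolve (suc m C_) (multichoose (suc m)) (suc n)
    ≡⟨ convolve-pascalʳ (suc m C_) (multichoose m) (multichoose (suc m))
         (sym (multichoose-zero m)) (multichoose-pascal m) n ⟩
  convolve (suc m C_) (multichoose m) (suc n) + convolve (suc m C_) (multichoose (suc m)) n
    ≡⟨ cong (_+ convolve (suc m C_) (multichoose (suc m)) n)
         (convolve-pascalˡ (m C_) (suc m C_) (multichoose m) refl
            (λ k → sym (nCk+nC[k+1]≡[n+1]C[k+1] m k)) n) ⟩
  convolve (m C_) (multichoose m) (suc n) + convolve (m C_) (multichoose m) n
    + convolve (suc m C_) (multichoose (suc m)) n
    ≡⟨ cong₂ _+_ (cong₂ _+_ (convolve-delannoy (suc n) m) (convolve-delannoy n m))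
         (convolve-delannoy n (suc m)) ⟩
  delannoy (suc n) m + delannoy n m + delannoy n (suc m)
    ≡⟨ +-comm _ (delannoy n (suc m)) ⟩
  delannoy n (suc m) + (delannoy (suc n) m + delannoy n m)
    ≡⟨ +-assoc (delannoy n (suc m)) _ _ ⟨
  delannoy (suc n) (suc m) ∎
  where open ≡-Reasoning

coefB-binomSum : ∀ n → (3 * n + 1) * coefB n 1 ≡ binomSum n
coefB-binomSum n = begin
  (3 * n + 1) * coefB n 1
    ≡⟨ coefB-delannoy n 1 ⟩
  1 * delannoy n (3 * n + 1)
    ≡⟨ *-identityˡ _ ⟩
  delannoy n (3 * n + 1)
    ≡⟨ cong (delannoy n) (+-comm (3 * n) 1) ⟩
  delannoy n (suc (3 * n))
    ≡⟨ convolve-delannoy n (suc (3 * n)) ⟨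
  convolve (suc (3 * n) C_) (multichoose (suc (3 * n))) n
    -- Only the first index is rewritten: `multichoose (suc (3 * n)) v` already unfolds to
    -- `(3 * n + v) C v`.
    ≡⟨ cong (λ m → convolve (m C_) (multichoose (suc (3 * n))) n) (+-comm (3 * n) 1) ⟨
  convolve ((3 * n + 1) C_) (multichoose (suc (3 * n))) n
    ≡⟨ sum-convolve ((3 * n + 1) C_) (multichoose (suc (3 * n))) n ⟨
  sum (applyUpTo (λ v → ((3 * n + 1) C (n ∸ v)) * ((3 * n + v) C v)) (suc n))
    ≡⟨ cong sum (map-applyUpTo id (λ v → ((3 * n + 1) C (n ∸ v)) * ((3 * n + v) C v)) (suc n)) ⟨
  binomSum n ∎
  where open ≡-Reasoning

-- Calculus of finite cardinalities.

HasCard-empty : (∀ x → ¬ P x) → HasCard P 0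
HasCard-empty ¬P = [] , [] , (λ x → mk⇔ (λ ()) (⊥-elim ∘ ¬P x)) , refl

HasCard-empty⁻¹ : HasCard P 0 → ∀ x → ¬ P x
HasCard-empty⁻¹ ([] , _ , ∈⇔ , _) x px with () ← from (∈⇔ x) px

HasCard-singleton : ∀ x → P x → (∀ y → P y → y ≡ x) → HasCard P 1
HasCard-singleton {P = P} x px only =
  x ∷ [] , ([] ∷ []) , (λ y → mk⇔ (λ { (here eq) → subst P (sym eq) px ; (there ()) }) (here ∘ only y)) , refl

HasCard-cong : (∀ x → P x ⇔ Q x) → HasCard P k → HasCard Q k
HasCard-cong P⇔Q (xs , uniq , ∈⇔ , len) =
  xs , uniq , (λ x → mk⇔ (to (P⇔Q x) ∘ to (∈⇔ x)) (from (∈⇔ x) ∘ from (P⇔Q x))) , len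

HasCard-⊎ : (∀ x → P x → ¬ Q x) → HasCard P k → HasCard Q l → HasCard (λ x → P x ⊎ Q x) (k + l)
HasCard-⊎ disjoint (xs , xs! , ∈xs⇔ , refl) (ys , ys! , ∈ys⇔ , refl) =
  xs ++ ys ,
  Unique.++⁺ xs! ys! (λ {x} (x∈xs , x∈ys) → disjoint x (to (∈xs⇔ x) x∈xs) (to (∈ys⇔ x) x∈ys)) ,
  (λ x → mk⇔ (Sum.map (to (∈xs⇔ x)) (to (∈ys⇔ x)) ∘ ∈-++⁻ xs)
             [ ∈-++⁺ˡ ∘ from (∈xs⇔ x) , ∈-++⁺ʳ xs ∘ from (∈ys⇔ x) ]′) ,
  length-++ xs

Image : (A → B → Set) → (A → Set) → B → Set
Image _~_ P y = ∃[ x ] (P x × x ~ y)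

-- A relation in place of a function, because a list can be decoded to a permutation only if it is a
-- valid word: an image is demanded on `P` alone.
HasCard-Image : (_~_ : A → B → Set) →
  (∀ {x} → P x → ∃[ y ] x ~ y) →
  (∀ {x y y′} → x ~ y → x ~ y′ → y ≡ y′) →
  (∀ {x x′ y} → x ~ y → x′ ~ y → x ≡ x′) →
  HasCard P k → HasCard (Image _~_ P) k
HasCard-Image {A} {B} {P = P} _~_ total functional injective (xs , xs! , ∈⇔ , refl) =
  let ys , ys! , len , ∈ys⇔ = images xs (to (∈⇔ _)) xs!
  in ys , ys! ,
     (λ y → mk⇔ (λ y∈ys → let x , x∈xs , x~y = to (∈ys⇔ y) y∈ys in x , to (∈⇔ x) x∈xs , x~y)
                (λ (x , px , x~y) → from (∈ys⇔ y) (x , from (∈⇔ x) px , x~y))) ,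
     len
  where
  images : ∀ xs → (∀ {x} → x ∈ xs → P x) → Unique xs →
    ∃[ ys ] (Unique ys × length ys ≡ length xs × (∀ y → y ∈ ys ⇔ (∃[ x ] (x ∈ xs × x ~ y))))
  images []       all []          = [] , [] , refl , λ y → mk⇔ (λ ()) (λ ())
  images (x ∷ xs) all (x∉xs ∷ xs!) with total (all (here refl)) | images xs (all ∘ there) xs!
  ... | y , x~y | ys , ys! , len , ∈ys⇔ =
    y ∷ ys ,
    (All.tabulate (λ y′∈ys y≡y′ →
       let x′ , x′∈xs , x′~y′ = to (∈ys⇔ _) y′∈ys
       in All.lookup x∉xs x′∈xs (injective (subst (x ~_) y≡y′ x~y) x′~y′)) ∷ ys!) ,
    cong suc len ,
    λ y′ → mk⇔ (λ { (here refl) → x , here refl , x~y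
                  ; (there y′∈ys) → let x′ , x′∈xs , x′~y′ = to (∈ys⇔ y′) y′∈ys
                                    in x′ , there x′∈xs , x′~y′ })
               (λ { (_ , here refl , x~y′) → here (functional x~y′ x~y)
                  ; (x′ , there x′∈xs , x′~y′) → there (from (∈ys⇔ y′) (x′ , x′∈xs , x′~y′)) })

HasCard-map : (f : A → B) → (∀ {x x′} → f x ≡ f x′ → x ≡ x′) →
  HasCard P k → HasCard (Image (λ x y → f x ≡ y) P) k
HasCard-map f injective = HasCard-Image (λ x y → f x ≡ y) (λ _ → _ , refl)
  (λ eq eq′ → trans (sym eq) eq′) (λ eq eq′ → injective (trans eq (sym eq′)))

Tail : (ℕ → A → Set) → ℕ → ℕ × A → Set
Tail X s (t , x) = s ≤ t × X t x

-- `g` is the tail sum of `f`. Since `g` vanishes beyond `N`, the induction can run downwards from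
-- there, with `d` as fuel.
HasCard-tail : (X : ℕ → A → Set) (f g : ℕ → ℕ) (N : ℕ) →
  (∀ t → g t ≡ f t + g (suc t)) → (∀ t → N < t → g t ≡ 0) →
  (∀ t → HasCard (X t) (f t)) →
  ∀ s → HasCard (Tail X s) (g s)
HasCard-tail {A} X f g N g-step g-vanish card s = downFrom (suc N) s (m≤n+m (suc N) s)
  where
  downFrom : ∀ d s → N < s + d → HasCard (Tail X s) (g s)
  -- Here the tail sum is 0, hence so is each term `f t` with t ≥ s, and each such `X t` is empty.
  downFrom zero s N<s+0 = subst (HasCard _) (sym (g-vanish s N<s)) (HasCard-empty λ (t , x) (s≤t , xt) →
      HasCard-empty⁻¹
        (subst (HasCard (X t))
          (m+n≡0⇒m≡0 (f t) (trans (sym (g-step t)) (g-vanish t (<-≤-trans N<s s≤t)))) (card t))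
        x xt)
    where
    N<s : N < s
    N<s = subst (N <_) (+-identityʳ s) N<s+0
  downFrom (suc d) s N<s+d = subst (HasCard _) (sym (g-step s))
    (HasCard-cong split
      (HasCard-⊎ disjoint
        (HasCard-map {P = X s} (s ,_) (λ { refl → refl }) (card s))
        (downFrom d (suc s) (subst (N <_) (+-suc s d) N<s+d))))
    where
    disjoint : ∀ p → Image (λ x p → (s , x) ≡ p) (X s) p → ¬ Tail X (suc s) p
    disjoint _ (_ , _ , refl) (s<t , _) = <-irrefl refl s<t
    split : ∀ p → (Image (λ x p → (s , x) ≡ p) (X s) p ⊎ Tail X (suc s) p) ⇔ Tail X s p
    split (t , x) = mk⇔
      (λ { (inj₁ (_ , xs , refl)) → ≤-refl , xs ; (inj₂ (s<t , xt)) → <⇒≤ s<t , xt })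
      (λ (s≤t , xt) → case s≤t xt (m≤n⇒m<n∨m≡n s≤t))
      where
      case : s ≤ t → X t x → s < t ⊎ s ≡ t → _
      case _ xt (inj₁ s<t)  = inj₂ (s<t , xt)
      case _ xt (inj₂ refl) = inj₁ (x , xt , refl)

-- Counting the codes for 312.

-- The coefficient [xᵏ] Dˢ Bᵖ, where D = 1 - 1 / B = x (B² + B³).
coefDB : ℕ → ℕ → ℕ → ℕ
coefDB k       zero    p = coefB k p
coefDB zero    (suc s) p = 0
coefDB (suc k) (suc s) p = coefDB k s (2 + p) + coefDB k s (3 + p)

-- This is 1 = 1 / B + D multiplied by Dˢ Bᵖ⁺¹. Read as a difference in `s`, it makes Dˢ Bᵖ⁺¹ the
-- tail sum of Dᵗ Bᵖ over t ≥ s, as `HasCard-tail` requires.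
coefDB-suc : ∀ k s p → coefDB k s (suc p) ≡ coefDB k s p + coefDB k (suc s) (suc p)
coefDB-suc zero    zero    p = refl
coefDB-suc (suc k) zero    p = refl
coefDB-suc zero    (suc s) p = refl
coefDB-suc (suc k) (suc s) p =
  trans (cong₂ _+_ (coefDB-suc k s (2 + p)) (coefDB-suc k s (3 + p)))
        (+-interchange (coefDB k s (2 + p)) (coefDB k (suc s) (3 + p))
          (coefDB k s (3 + p)) (coefDB k (suc s) (4 + p)))

-- D is divisible by x; this makes the tail sums finite.
coefDB-vanish : ∀ k s p → k < s → coefDB k s p ≡ 0
coefDB-vanish zero    (suc s) p k<s       = refl
coefDB-vanish (suc k) (suc s) p (s≤s k<s) =
  cong₂ _+_ (coefDB-vanish k s (2 + p) k<s) (coefDB-vanish k s (3 + p) k<s)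

-- The bound on an entry placed in front of the list. With default 0 it also expresses that the last
-- entry of a Lehmer code is 0.
height : ℕ → List ℕ → ℕ
height h []      = h
height h (x ∷ _) = suc x

-- Three code entries per block; h bounds the very last entry, as `height h` of the empty tail.
data Word (Block : ℕ → ℕ → ℕ → Set) (h : ℕ) : ℕ → List ℕ → Set where
  []    : Word Block h 0 []
  block : ∀ {n x y z w} → Block x y z → z ≤ height h w → Word Block h n w →
          Word Block h (suc n) (x ∷ y ∷ z ∷ w)

-- The code entries of a block whose first value is least. The neighbour bound x ≤ y + 1 is implied
-- by x ≤ y.
Ascent : ℕ → ℕ → ℕ → Set
Ascent x y z = x ≤ y × x ≤ z × y ≤ suc z

AscentWord : ℕ → List ℕ → Set
AscentWord = Word Ascent 0

-- The series are Dˢ B, Dˢ⁺¹ B and Dˢ⁺¹. The recursion is mutual: sorting by the first entry leads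
-- from the second to the third, and removing the first block leads from the third to the first with
-- fewer blocks.
HasCard-AscentWord-≤height : ∀ k s → HasCard (λ w → AscentWord k w × s ≤ height 0 w) (coefDB k s 1)
HasCard-AscentWord-<height : ∀ k s →
  HasCard (λ w → AscentWord (suc k) w × s < height 0 w) (coefDB (suc k) (suc s) 1)
HasCard-AscentWord-∷ : ∀ k s → HasCard (λ w → AscentWord (suc k) (s ∷ w)) (coefDB (suc k) (suc s) 0)

HasCard-AscentWord-≤height zero zero = HasCard-singleton [] ([] , z≤n) (λ { _ ([] , _) → refl })
HasCard-AscentWord-≤height zero (suc s) = HasCard-empty (λ { _ ([] , ()) })
HasCard-AscentWord-≤height (suc k) zero =
  HasCard-cong (λ _ → mk⇔ (λ { (block b h w , _) → block b h w , z≤n })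
                          (λ { (block b h w , _) → block b h w , s≤s z≤n }))
    (HasCard-AscentWord-<height k 0)
HasCard-AscentWord-≤height (suc k) (suc s) = HasCard-AscentWord-<height k s

HasCard-AscentWord-<height k s =
  HasCard-cong (λ _ → mk⇔ (λ { ((t , w) , (s≤t , tw) , refl) → tw , s≤s s≤t })
                          (λ { (block b h w , s≤s s≤t) → _ , (s≤t , block b h w) , refl }))
    (HasCard-map (λ (t , w) → t ∷ w) (λ { refl → refl })
      (HasCard-tail (λ t w → AscentWord (suc k) (t ∷ w))
        (λ t → coefDB (suc k) (suc t) 0) (λ t → coefDB (suc k) (suc t) 1) (suc k)
        (λ t → coefDB-suc (suc k) (suc t) 0) (λ t k<t → coefDB-vanish (suc k) (suc t) 1 (m<n⇒m<1+n k<t))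
        (HasCard-AscentWord-∷ k) s))

-- A block s, u, t has either u = t + 1 ≥ s + 1 or s ≤ u ≤ t: the two summands of D = x (B² + B³).
HasCard-AscentWord-∷ k s = HasCard-cong split (HasCard-⊎ disjoint
    (HasCard-map f₁ (λ { refl → refl }) (pairs s))
    (HasCard-map f₂ (λ { refl → refl }) (triples s)))
  where
  f₁ : ℕ × List ℕ → List ℕ
  f₁ (t , w) = suc t ∷ t ∷ w
  f₂ : ℕ × ℕ × List ℕ → List ℕ
  f₂ (u , t , w) = u ∷ t ∷ w
  Pair : ℕ → ℕ × List ℕ → Set
  Pair = Tail (λ t w → AscentWord k w × t ≤ height 0 w)
  Triple : ℕ → ℕ × ℕ × List ℕ → Set
  Triple = Tail Pair
  -- Each of the two tail sums raises the exponent of B by one: Dᵗ B becomes Dˢ B², then Dˢ B³.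
  pairs : ∀ s → HasCard (Pair s) (coefDB k s 2)
  pairs = HasCard-tail (λ t w → AscentWord k w × t ≤ height 0 w)
    (λ t → coefDB k t 1) (λ t → coefDB k t 2) k
    (λ t → coefDB-suc k t 1) (λ t → coefDB-vanish k t 2) (HasCard-AscentWord-≤height k)
  triples : ∀ s → HasCard (Triple s) (coefDB k s 3)
  triples = HasCard-tail Pair (λ t → coefDB k t 2) (λ t → coefDB k t 3) k
    (λ t → coefDB-suc k t 2) (λ t → coefDB-vanish k t 3) pairs
  disjoint : ∀ w → Image (λ x y → f₁ x ≡ y) (Pair s) w → ¬ Image (λ x y → f₂ x ≡ y) (Triple s) w
  disjoint _ (_ , _ , refl) (_ , (_ , (t<t , _)) , refl) = <-irrefl refl t<t
  split : ∀ w → (Image (λ x y → f₁ x ≡ y) (Pair s) w ⊎ Image (λ x y → f₂ x ≡ y) (Triple s) w) ⇔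
    AscentWord (suc k) (s ∷ w)
  split w = mk⇔
    (λ { (inj₁ (_ , (s≤t , ww , t≤h) , refl)) → block (m≤n⇒m≤1+n s≤t , s≤t , ≤-refl) t≤h ww
       ; (inj₂ (_ , (s≤u , u≤t , ww , t≤h) , refl)) →
           block (s≤u , ≤-trans s≤u u≤t , m≤n⇒m≤1+n u≤t) t≤h ww })
    λ { (block (s≤u , s≤t , u≤1+t) t≤h ww) → case s≤u s≤t t≤h ww (m≤n⇒m<n∨m≡n u≤1+t) }
    where
    case : ∀ {u t w} → s ≤ u → s ≤ t → t ≤ height 0 w → AscentWord k w → u < suc t ⊎ u ≡ suc t →
      Image (λ x y → f₁ x ≡ y) (Pair s) (u ∷ t ∷ w) ⊎ Image (λ x y → f₂ x ≡ y) (Triple s) (u ∷ t ∷ w)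
    case s≤u s≤t t≤h ww (inj₁ (s≤s u≤t)) = inj₂ (_ , (s≤u , u≤t , ww , t≤h) , refl)
    case s≤u s≤t t≤h ww (inj₂ refl)      = inj₁ (_ , (s≤t , ww , t≤h) , refl)

HasCard-AscentWord : ∀ n → HasCard (AscentWord n) (coefB n 1)
HasCard-AscentWord n = HasCard-cong (λ _ → mk⇔ proj₁ (_, z≤n)) (HasCard-AscentWord-≤height n 0)

-- Counting the codes for 213.

-- The code entries of a block of the reversed permutation.
Descent : ℕ → ℕ → ℕ → Set
Descent x y z = y ≡ suc z × (x ≡ suc z ⊎ x ≡ suc (suc z))

append₃ : ℕ → ℕ → ℕ → List ℕ → List ℕ
append₃ x y z w = ((w ∷ʳ x) ∷ʳ y) ∷ʳ z

append₃-injective : ∀ {x y z x′ y′ z′} w w′ → append₃ x y z w ≡ append₃ x′ y′ z′ w′ →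
  w ≡ w′ × x ≡ x′ × y ≡ y′ × z ≡ z′
append₃-injective w w′ eq =
  let eq₂ , z≡z′ = ∷ʳ-injective _ _ eq
      eq₁ , y≡y′ = ∷ʳ-injective _ _ eq₂
      eq₀ , x≡x′ = ∷ʳ-injective w w′ eq₁
  in eq₀ , x≡x′ , y≡y′ , z≡z′

height-append₃ : ∀ h x y z w → height h (append₃ x y z w) ≡ height (suc x) w
height-append₃ h x y z []      = refl
height-append₃ h x y z (_ ∷ _) = refl

-- The new block supplies the right neighbour that the last entry of `w` lacked, so the default
-- bound for `w` is `suc x`.
Word-append₃ : ∀ {h n x y z w} → Block x y z → z ≤ h → Word Block (suc x) n w →
  Word Block h (suc n) (append₃ x y z w)
Word-append₃ b z≤h [] = block b z≤h []
Word-append₃ {h = h} {x = x} {y} {z} b z≤h (block {w = w} b′ z′≤ ww) =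
  block b′ (subst (_ ≤_) (sym (height-append₃ h x y z w)) z′≤) (Word-append₃ b z≤h ww)

Word-append₃⁻¹ : ∀ {h n v} → Word Block h (suc n) v →
  ∃[ x ] ∃[ y ] ∃[ z ] ∃[ w ] (Block x y z × z ≤ h × Word Block (suc x) n w × append₃ x y z w ≡ v)
Word-append₃⁻¹ (block b z≤h []) = _ , _ , _ , [] , b , z≤h , [] , refl
Word-append₃⁻¹ {h = h} (block {x = x′} {y′} {z′} b′ z′≤ ww@(block _ _ _)) =
  let x , y , z , w , b , z≤h , ww′ , eq = Word-append₃⁻¹ ww
  in x , y , z , x′ ∷ y′ ∷ z′ ∷ w , b , z≤h ,
     block b′ (subst (z′ ≤_) (trans (cong (height h) (sym eq)) (height-append₃ h x y z w)) z′≤) ww′ ,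
     cong (λ v → x′ ∷ y′ ∷ z′ ∷ v) eq

-- If the last entry is c, its block starts with c + 1 or c + 2, and the word in front has the bound
-- c + 2 or c + 3. This gives x (Bᶜ⁺³ + Bᶜ⁺⁴) = Bᶜ⁺¹ - Bᶜ, which telescopes over c ≤ h.
HasCard-DescentWord : ∀ n h → HasCard (Word Descent h n) (coefB n (suc h))
HasCard-DescentWord zero h = HasCard-singleton [] [] (λ { _ [] → refl })
HasCard-DescentWord (suc n) = card
  where
  EndsIn : ℕ → ℕ → List ℕ → Set
  EndsIn d h = Image (λ w v → append₃ (d + h) (suc h) h w ≡ v) (Word Descent (suc (d + h)) n)

  Last : ℕ → List ℕ → Set
  Last h v = EndsIn 1 h v ⊎ EndsIn 2 h v

  endsIn : ∀ d h → HasCard (EndsIn d h) (coefB n (2 + (d + h)))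
  endsIn d h = HasCard-map (append₃ (d + h) (suc h) h)
    (proj₁ ∘ append₃-injective _ _) (HasCard-DescentWord n (suc (d + h)))

  last : ∀ h → HasCard (Last h) (coefB n (3 + h) + coefB n (4 + h))
  last h = HasCard-⊎ disjoint (endsIn 1 h) (endsIn 2 h)
    where
    disjoint : ∀ v → EndsIn 1 h v → ¬ EndsIn 2 h v
    disjoint _ (w , _ , refl) (w′ , _ , eq) =
      1+n≢n (proj₁ (proj₂ (append₃-injective w′ w eq)))

  last⇒word : ∀ {h c v} → c ≤ h → Last c v → Word Descent h (suc n) v
  last⇒word c≤h (inj₁ (_ , ww , refl)) = Word-append₃ (refl , inj₁ refl) c≤h ww
  last⇒word c≤h (inj₂ (_ , ww , refl)) = Word-append₃ (refl , inj₂ refl) c≤h ww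

  word⇒last : ∀ {h v} → Word Descent h (suc n) v → ∃[ c ] (c ≤ h × Last c v)
  word⇒last ww with Word-append₃⁻¹ ww
  ... | _ , _ , c , w , (refl , inj₁ refl) , c≤h , ww′ , eq = c , c≤h , inj₁ (w , ww′ , eq)
  ... | _ , _ , c , w , (refl , inj₂ refl) , c≤h , ww′ , eq = c , c≤h , inj₂ (w , ww′ , eq)

  last-unique : ∀ {c c′ v} → Last c v → Last c′ v → c ≡ c′
  last-unique p q = let _ , w , eq = ending p ; _ , w′ , eq′ = ending q
                    in proj₂ (proj₂ (proj₂ (append₃-injective w w′ (trans eq (sym eq′)))))
    where
    ending : ∀ {c v} → Last c v → ∃[ x ] ∃[ w ] append₃ x (suc c) c w ≡ v
    ending (inj₁ (w , _ , eq)) = _ , w , eq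
    ending (inj₂ (w , _ , eq)) = _ , w , eq

  card : ∀ h → HasCard (Word Descent h (suc n)) (coefB (suc n) (suc h))
  card zero = HasCard-cong
    (λ v → mk⇔ (last⇒word z≤n) (λ ww → case (word⇒last ww))) (last 0)
    where
    case : ∀ {v} → ∃[ c ] (c ≤ 0 × Last c v) → Last 0 v
    case (_ , z≤n , l) = l
  card (suc h) = HasCard-cong
    (λ v → mk⇔ [ (λ ww → let c , c≤h , l = word⇒last ww in last⇒word (m≤n⇒m≤1+n c≤h) l)
               , last⇒word ≤-refl ]′
               (λ ww → case (word⇒last ww)))
    (HasCard-⊎ disjoint (card h) (last (suc h)))
    where
    disjoint : ∀ v → Word Descent h (suc n) v → ¬ Last (suc h) v
    disjoint v ww l with word⇒last ww
    ... | c , c≤h , l′ = <⇒≢ (s≤s c≤h) (last-unique l′ l)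
    case : ∀ {v} → ∃[ c ] (c ≤ suc h × Last c v) → Word Descent h (suc n) v ⊎ Last (suc h) v
    case (c , c≤1+h , l) with m≤n⇒m<n∨m≡n c≤1+h
    ... | inj₁ (s≤s c≤h) = inj₁ (last⇒word c≤h l)
    ... | inj₂ refl      = inj₂ l

-- Lehmer codes and 312-avoidance.

toℕ-punchIn-< : ∀ (i : Fin (suc n)) j → toℕ j < toℕ i → toℕ (punchIn i j) ≡ toℕ j
toℕ-punchIn-< (suc i) zero    _         = refl
toℕ-punchIn-< (suc i) (suc j) (s≤s j<i) = cong suc (toℕ-punchIn-< i j j<i)

toℕ-punchIn-≥ : ∀ (i : Fin (suc n)) j → toℕ i ≤ toℕ j → toℕ (punchIn i j) ≡ suc (toℕ j)
toℕ-punchIn-≥ zero    j       _         = refl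
toℕ-punchIn-≥ (suc i) (suc j) (s≤s i≤j) = cong suc (toℕ-punchIn-≥ i j i≤j)

punchIn<⇒< : ∀ (i : Fin (suc n)) j → toℕ (punchIn i j) < toℕ i → toℕ j < toℕ i
punchIn<⇒< i j pj<i = ≰⇒> λ i≤j →
  <⇒≱ (subst (_< toℕ i) (toℕ-punchIn-≥ i j i≤j) pj<i) (m≤n⇒m≤1+n i≤j)

<⇒punchIn< : ∀ (i : Fin (suc n)) j → toℕ j < toℕ i → toℕ (punchIn i j) < toℕ i
<⇒punchIn< i j j<i = subst (_< toℕ i) (sym (toℕ-punchIn-< i j j<i)) j<i

<punchIn⇒≤ : ∀ (i : Fin (suc n)) j → toℕ i < toℕ (punchIn i j) → toℕ i ≤ toℕ j
<punchIn⇒≤ i j i<pj = ≮⇒≥ λ j<i → <-asym i<pj (<⇒punchIn< i j j<i)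

≤⇒<punchIn : ∀ (i : Fin (suc n)) j → toℕ i ≤ toℕ j → toℕ i < toℕ (punchIn i j)
≤⇒<punchIn i j i≤j = subst (toℕ i <_) (sym (toℕ-punchIn-≥ i j i≤j)) (s≤s i≤j)

StrictlyMonotone : (Fin m → Fin n) → Set
StrictlyMonotone f = ∀ {i j} → toℕ i < toℕ j ⇔ toℕ (f i) < toℕ (f j)

punchIn-strictlyMonotone : ∀ (i : Fin (suc n)) → StrictlyMonotone (punchIn i)
punchIn-strictlyMonotone i {j} {k} = mk⇔
  (λ j<k → ≰⇒> (<⇒≱ j<k ∘ punchIn-cancel-≤ i k j))
  (λ pj<pk → ≰⇒> (<⇒≱ pj<pk ∘ punchIn-mono-≤ i k j))

infixr 5 _∷_

-- Lehmer codes: each entry counts the smaller entries to its right.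
data Code : ℕ → Set where
  []  : Code 0
  _∷_ : Fin (suc n) → Code n → Code (suc n)

perm : Code n → Fin n → Fin n
perm (x ∷ c) zero    = x
perm (x ∷ c) (suc i) = punchIn x (perm c i)

toList : Code n → List ℕ
toList []      = []
toList (x ∷ c) = toℕ x ∷ toList c

toList-injective : (c c′ : Code n) → toList c ≡ toList c′ → c ≡ c′
toList-injective []      []        _  = refl
toList-injective (x ∷ c) (x′ ∷ c′) eq with ∷-injective eq
... | x≡x′ , c≡c′ = cong₂ _∷_ (toℕ-injective x≡x′) (toList-injective c c′ c≡c′)

height-toList : (c : Code n) → height 0 (toList c) ≤ n
height-toList []      = z≤n
height-toList (x ∷ c) = toℕ<n x

perm-injective : (c : Code n) → ∀ i j → perm c i ≡ perm c j → i ≡ j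
perm-injective (x ∷ c) zero    zero    _  = refl
perm-injective (x ∷ c) zero    (suc j) eq = contradiction (sym eq) (punchInᵢ≢i x _)
perm-injective (x ∷ c) (suc i) zero    eq = contradiction eq (punchInᵢ≢i x _)
perm-injective (x ∷ c) (suc i) (suc j) eq =
  cong suc (perm-injective c i j (punchIn-injective x _ _ eq))

perm-surjective : (c : Code n) → ∀ v → ∃[ i ] perm c i ≡ v
perm-surjective (x ∷ c) v with x ≟ v
... | yes refl = zero , refl
... | no  x≢v  = let i , eq = perm-surjective c (punchOut x≢v)
                 in suc i , trans (cong (punchIn x) eq) (punchIn-punchOut x≢v)

perm-determines-code : (c c′ : Code n) → (∀ i → perm c i ≡ perm c′ i) → c ≡ c′
perm-determines-code []      []        _  = refl
perm-determines-code (x ∷ c) (x′ ∷ c′) eq with eq zero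
... | refl = cong (x ∷_) (perm-determines-code c c′ λ i → punchIn-injective x _ _ (eq (suc i)))

encode : (f : Fin n → Fin n) → (∀ i j → f i ≡ f j → i ≡ j) → ∃[ c ] (∀ i → perm c i ≡ f i)
encode {zero}  f inj = [] , λ ()
encode {suc n} f inj =
  let c , eq = encode (λ i → punchOut (f0≢ i))
                 (λ i j eq → suc-injective (inj _ _ (punchOut-injective (f0≢ i) (f0≢ j) eq)))
  in f zero ∷ c , λ { zero    → refl
                    ; (suc i) → trans (cong (punchIn (f zero)) (eq i)) (punchIn-punchOut (f0≢ i)) }
  where
  f0≢ : ∀ i → f zero ≢ f (suc i)
  f0≢ i eq with () ← inj zero (suc i) eq

Occurs312 Occurs213 : (Fin m → ℕ) → Set
Occurs312 f = ∃[ i ] ∃[ j ] ∃[ k ] (toℕ i < toℕ j × toℕ j < toℕ k × f j < f k × f k < f i)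
Occurs213 f = ∃[ i ] ∃[ j ] ∃[ k ] (toℕ i < toℕ j × toℕ j < toℕ k × f j < f i × f i < f k)

data Stacked : Code n → Set where
  []  : Stacked []
  _∷_ : ∀ {x} {c : Code n} → toℕ x ≤ height 0 (toList c) → Stacked c → Stacked (x ∷ c)

-- If a pattern starts at x, its third value, relative to `y ∷ c`, is at most y because x ≤ y + 1.
-- It is not y, which stands too far left, so it is below y; then y can play the part of x, and the
-- pattern lies in `y ∷ c`.
stacked⇒avoids : {c : Code n} → Stacked c → ¬ Occurs312 (toℕ ∘ perm c)
stacked⇒avoids {c = x ∷ c} (_ ∷ s) (suc i , suc j , suc k , s≤s i<j , s≤s j<k , j<ₚk , k<ₚi) =
  stacked⇒avoids s (i , j , k , i<j , j<k ,
    from (punchIn-strictlyMonotone x) j<ₚk , from (punchIn-strictlyMonotone x) k<ₚi)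
stacked⇒avoids {c = x ∷ y ∷ c} (x≤1+y ∷ s) (zero , suc j , suc k , _ , s≤s j<k , j<ₚk , k<ₚ0) =
  case (m≤n⇒m<n∨m≡n v≤y)
  where
  u<v : toℕ (perm (y ∷ c) j) < toℕ (perm (y ∷ c) k)
  u<v = from (punchIn-strictlyMonotone x) j<ₚk
  v≤y : toℕ (perm (y ∷ c) k) ≤ toℕ y
  v≤y = ≤-pred (<-≤-trans (punchIn<⇒< x _ k<ₚ0) x≤1+y)
  case : toℕ (perm (y ∷ c) k) < toℕ y ⊎ toℕ (perm (y ∷ c) k) ≡ toℕ y → ⊥
  case (inj₂ v≡y) =
    n≮0 (subst (λ i → toℕ j < toℕ i) (perm-injective (y ∷ c) k zero (toℕ-injective v≡y)) j<k)
  case (inj₁ v<y) = below j j<k u<v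
    where
    below : ∀ j → toℕ j < toℕ k → toℕ (perm (y ∷ c) j) < toℕ (perm (y ∷ c) k) → ⊥
    below zero    _   y<v = <-asym y<v v<y
    below (suc j) j<k u<v = stacked⇒avoids s (zero , suc j , k , z<s , j<k , u<v , v<y)

avoids⇒stacked : (c : Code n) → ¬ Occurs312 (toℕ ∘ perm c) → Stacked c
avoids⇒stacked []      _     = []
avoids⇒stacked (x ∷ c) avoids = bound x c avoids ∷ avoids⇒stacked c
  λ (i , j , k , i<j , j<k , j<ₚk , k<ₚi) → avoids (suc i , suc j , suc k , s<s i<j , s<s j<k ,
    to (punchIn-strictlyMonotone x) j<ₚk , to (punchIn-strictlyMonotone x) k<ₚi)
  where
  bound : ∀ {n} (x : Fin (suc n)) c → ¬ Occurs312 (toℕ ∘ perm (x ∷ c)) → toℕ x ≤ height 0 (toList c)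
  bound zero []      _      = z≤n
  bound {suc n} x (y ∷ c) avoids = ≮⇒≥ λ 1+y<x →
    -- otherwise x, y and the later occurrence of y + 1 form the pattern
    let 1+y<n = <-≤-trans 1+y<x (≤-pred (toℕ<n x))
        v = fromℕ< 1+y<n
        v≡1+y = toℕ-fromℕ< 1+y<n
        k , pk≡v = perm-surjective (y ∷ c) v
        toℕ-pk = trans (cong toℕ pk≡v) v≡1+y
    in avoids (zero , suc zero , suc k , z<s , s<s (positive k toℕ-pk) ,
         to (punchIn-strictlyMonotone x) (≤-reflexive (sym toℕ-pk)) ,
         <⇒punchIn< x _ (subst (_< toℕ x) (sym toℕ-pk) 1+y<x))
    where
    positive : ∀ k → toℕ (perm (y ∷ c) k) ≡ suc (toℕ y) → 0 < toℕ k
    positive zero    eq = contradiction (sym eq) 1+n≢n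
    positive (suc k) eq = z<s

-- Block conditions on values and on code entries.

-- Shaped so that `EveryBlock FirstLeast (val π)` unfolds to `BlockCond n π`.
EveryBlock : (ℕ → ℕ → ℕ → Set) → (Fin m → ℕ) → Set
EveryBlock {m} T f = (i : ℕ) (p q r : Fin m) →
  toℕ p ≡ 3 * i → toℕ q ≡ 3 * i + 1 → toℕ r ≡ 3 * i + 2 → T (f p) (f q) (f r)

EveryBlock-cong : ∀ (T : ℕ → ℕ → ℕ → Set) {f g : Fin m → ℕ} → (∀ i → f i ≡ g i) →
  EveryBlock T f → EveryBlock T g
EveryBlock-cong T f≗g bs i p q r p≡ q≡ r≡ =
  subst (λ a → T a _ _) (f≗g p) (subst (λ b → T _ b _) (f≗g q) (subst (λ c → T _ _ c) (f≗g r)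
    (bs i p q r p≡ q≡ r≡)))

EveryBlock-cons : ∀ (T : ℕ → ℕ → ℕ → Set) (f : Fin (3 + m) → ℕ) →
  T (f zero) (f (suc zero)) (f (suc (suc zero))) → EveryBlock T (λ i → f (suc (suc (suc i)))) →
  EveryBlock T f
EveryBlock-cons T f b bs zero zero (suc zero) (suc (suc zero)) _ _ _ = b
EveryBlock-cons T f b bs (suc i) p q r p≡ q≡ r≡ = shifted p q r
  (trans p≡ (*-suc 3 i)) (trans q≡ (cong (_+ 1) (*-suc 3 i))) (trans r≡ (cong (_+ 2) (*-suc 3 i)))
  where
  shifted : ∀ p q r → toℕ p ≡ 3 + 3 * i → toℕ q ≡ 3 + 3 * i + 1 → toℕ r ≡ 3 + 3 * i + 2 →
    T (f p) (f q) (f r)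
  shifted (suc (suc (suc p))) (suc (suc (suc q))) (suc (suc (suc r))) p≡ q≡ r≡ =
    bs i p q r (+-cancelˡ-≡ 3 _ _ p≡) (+-cancelˡ-≡ 3 _ _ q≡) (+-cancelˡ-≡ 3 _ _ r≡)

EveryBlock-uncons : ∀ (T : ℕ → ℕ → ℕ → Set) (f : Fin (3 + m) → ℕ) → EveryBlock T f →
  T (f zero) (f (suc zero)) (f (suc (suc zero))) × EveryBlock T (λ i → f (suc (suc (suc i))))
EveryBlock-uncons T f bs =
  bs 0 _ _ _ refl refl refl ,
  λ i p q r p≡ q≡ r≡ → bs (suc i) _ _ _
    (trans (cong (3 +_) p≡) (sym (*-suc 3 i)))
    (trans (cong (3 +_) q≡) (cong (_+ 1) (sym (*-suc 3 i))))
    (trans (cong (3 +_) r≡) (cong (_+ 2) (sym (*-suc 3 i))))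

-- What makes `Block` the code version of the condition `T` under 312-avoidance. The triples x,
-- `punchIn x y`, `punchIn x (punchIn y z)` are the first three values of `perm (x ∷ y ∷ z ∷ c)`;
-- `invariant` reduces every other block to this case.
record BlockCode (T Block : ℕ → ℕ → ℕ → Set) : Set where
  field
    invariant : ∀ {m n} (f : Fin m → Fin n) → StrictlyMonotone f → ∀ {i j k} →
      T (toℕ i) (toℕ j) (toℕ k) ⇔ T (toℕ (f i)) (toℕ (f j)) (toℕ (f k))
    bounded : ∀ {x y z} → Block x y z → x ≤ suc y × y ≤ suc z
    decodes : ∀ (x : Fin (3 + m)) y z → Block (toℕ x) (toℕ y) (toℕ z) →
      T (toℕ x) (toℕ (punchIn x y)) (toℕ (punchIn x (punchIn y z)))
    encodes : ∀ (x : Fin (3 + m)) y z → toℕ x ≤ suc (toℕ y) → toℕ y ≤ suc (toℕ z) →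
      T (toℕ x) (toℕ (punchIn x y)) (toℕ (punchIn x (punchIn y z))) →
      Block (toℕ x) (toℕ y) (toℕ z)

module Counting {T Block : ℕ → ℕ → ℕ → Set} (blockCode : BlockCode T Block) where
  open BlockCode blockCode

  -- Unlike 3 * n, this unfolds to three successors.
  thrice : ℕ → ℕ
  thrice zero    = 0
  thrice (suc n) = 3 + thrice n

  thrice≡3* : ∀ n → thrice n ≡ 3 * n
  thrice≡3* zero    = refl
  thrice≡3* (suc n) = trans (cong (3 +_) (thrice≡3* n)) (sym (*-suc 3 n))

  punchIn₃-invariant : ∀ (x : Fin (3 + m)) y z {i j k} →
    T (toℕ i) (toℕ j) (toℕ k) ⇔
    T (toℕ (punchIn x (punchIn y (punchIn z i)))) (toℕ (punchIn x (punchIn y (punchIn z j))))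
      (toℕ (punchIn x (punchIn y (punchIn z k))))
  punchIn₃-invariant x y z = invariant (punchIn x ∘ punchIn y ∘ punchIn z)
    (mk⇔ (to (↑ x) ∘ to (↑ y) ∘ to (↑ z)) (from (↑ z) ∘ from (↑ y) ∘ from (↑ x)))
    where
    ↑ : ∀ {n} (i : Fin (suc n)) → StrictlyMonotone (punchIn i)
    ↑ = punchIn-strictlyMonotone

  Encodes : ∀ {m} → Code m → Set
  Encodes c = Stacked c × EveryBlock T (toℕ ∘ perm c)

  encodes⇒word : ∀ n (c : Code (thrice n)) → Encodes c → Word Block 0 n (toList c)
  encodes⇒word zero    []              _                        = []
  encodes⇒word (suc n) (x ∷ y ∷ z ∷ c) (x≤ ∷ y≤ ∷ z≤ ∷ s , bs) =
    let b , bs′ = EveryBlock-uncons T _ bs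
    in block (encodes x y z x≤ y≤ b) z≤ (encodes⇒word n c (s ,
         λ i p q r p≡ q≡ r≡ → from (punchIn₃-invariant x y z) (bs′ i p q r p≡ q≡ r≡)))

  word⇒encodes : ∀ {n w} → Word Block 0 n w → ∃[ c ] (toList {thrice n} c ≡ w × Encodes c)
  word⇒encodes [] = [] , refl , [] , λ _ ()
  word⇒encodes (block {x = x} {y} {z} b z≤ ww) with word⇒encodes ww
  ... | c , refl , s , bs = extend (fin z z≤m) (fin y y≤m) (fin x x≤m)
    where
    fin : ∀ {m} x → x ≤ m → ∃[ i ] toℕ {suc m} i ≡ x
    fin x x≤m = fromℕ< (s≤s x≤m) , toℕ-fromℕ< (s≤s x≤m)
    -- The entries fit into `Fin` because each may exceed its right neighbour by one, just as the
    -- size of `Fin` grows by one per entry.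
    z≤m = ≤-trans z≤ (height-toList c)
    y≤m = ≤-trans (proj₂ (bounded b)) (s≤s z≤m)
    x≤m = ≤-trans (proj₁ (bounded b)) (s≤s y≤m)
    extend : (∃[ i ] toℕ i ≡ z) → (∃[ i ] toℕ i ≡ y) → (∃[ i ] toℕ i ≡ x) →
      ∃[ c′ ] (toList c′ ≡ x ∷ y ∷ z ∷ toList c × Encodes c′)
    extend (z , refl) (y , refl) (x , refl) =
      x ∷ y ∷ z ∷ c , refl , proj₁ (bounded b) ∷ proj₂ (bounded b) ∷ z≤ ∷ s ,
      EveryBlock-cons T _ (decodes x y z b)
        λ i p q r p≡ q≡ r≡ → to (punchIn₃-invariant x y z) (bs i p q r p≡ q≡ r≡)

  Admissible : ∀ {m} → (Fin m → Fin m) → Set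
  Admissible f = (∀ i j → f i ≡ f j → i ≡ j) × ¬ Occurs312 (toℕ ∘ f) × EveryBlock T (toℕ ∘ f)

  Admissible-cong : ∀ {m} {f g : Fin m → Fin m} → (∀ i → f i ≡ g i) → Admissible f → Admissible g
  Admissible-cong f≗g (inj , avoids , bs) =
    (λ i j eq → inj i j (trans (f≗g i) (trans eq (sym (f≗g j))))) ,
    (λ (i , j , k , i<j , j<k , lt , lt′) → avoids (i , j , k , i<j , j<k ,
       subst₂ _<_ (cong toℕ (sym (f≗g j))) (cong toℕ (sym (f≗g k))) lt ,
       subst₂ _<_ (cong toℕ (sym (f≗g k))) (cong toℕ (sym (f≗g i))) lt′)) ,
    EveryBlock-cong T (cong toℕ ∘ f≗g) bs

  -- `σ` is the identity for 312 and the reversal of positions for 213.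
  HasCard-Admissible : (σ : Fin (3 * n) → Fin (3 * n)) → (∀ i → σ (σ i) ≡ i) →
    HasCard (Word Block 0 n) k → HasCard (λ π → Admissible (lookup π ∘ σ)) k
  HasCard-Admissible {n} σ σ-involutive card =
    HasCard-cong (λ π → mk⇔ (image⇒admissible π) (admissible⇒image π))
      (HasCard-Image _~_ total
        (λ {w} {π} {π′} → functional {w} {π} {π′})
        (λ {w} {w′} {π} → injective {w} {w′} {π}) card)
    where
    _~_ : List ℕ → Vec (Fin (3 * n)) (3 * n) → Set
    w ~ π = ∃[ c ] (toList c ≡ w × (∀ i → perm c i ≡ lookup π (σ i)))

    fromWord : ∀ {w} → Word Block 0 n w → ∃[ c ] (toList {3 * n} c ≡ w × Encodes c)
    fromWord {w} ww =
      subst (λ m → ∃[ c ] (toList {m} c ≡ w × Encodes c)) (thrice≡3* n) (word⇒encodes ww)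

    toWord : (c : Code (3 * n)) → Encodes c → Word Block 0 n (toList c)
    toWord = subst (λ m → (c : Code m) → Encodes c → Word Block 0 n (toList c))
      (thrice≡3* n) (encodes⇒word n)

    total : ∀ {w} → Word Block 0 n w → ∃[ π ] w ~ π
    total ww = let c , eq , _ = fromWord ww in
      tabulate (perm c ∘ σ) , c , eq ,
      λ i → sym (trans (lookup∘tabulate (perm c ∘ σ) (σ i)) (cong (perm c) (σ-involutive i)))

    functional : ∀ {w π π′} → w ~ π → w ~ π′ → π ≡ π′
    functional {_} {π} {π′} (c , eq , c~π) (c′ , eq′ , c′~π′)
      with refl ← toList-injective c c′ (trans eq (sym eq′)) =
      trans (sym (tabulate∘lookup π))
        (trans (tabulate-cong λ i → subst (λ j → lookup π j ≡ lookup π′ j) (σ-involutive i)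
                  (trans (sym (c~π (σ i))) (c′~π′ (σ i))))
          (tabulate∘lookup π′))

    injective : ∀ {w w′ π} → w ~ π → w′ ~ π → w ≡ w′
    injective (c , refl , c~π) (c′ , refl , c′~π) =
      cong toList (perm-determines-code c c′ λ i → trans (c~π i) (sym (c′~π i)))

    image⇒admissible : ∀ π → Image _~_ (Word Block 0 n) π → Admissible (lookup π ∘ σ)
    image⇒admissible π (w , ww , c , eq , c~π) with fromWord ww
    ... | c′ , eq′ , s , bs with refl ← toList-injective c c′ (trans eq (sym eq′)) =
      Admissible-cong c~π (perm-injective c , stacked⇒avoids s , bs)

    admissible⇒image : ∀ π → Admissible (lookup π ∘ σ) → Image _~_ (Word Block 0 n) π
    admissible⇒image π adm@(inj , _ , _) =
      let c , c~π = encode (lookup π ∘ σ) inj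
          _ , avoids , bs = Admissible-cong (sym ∘ c~π) adm
      in toList c , toWord c (avoids⇒stacked c avoids , bs) , c , refl , c~π

-- The two instances: least value first or last in its block.

FirstLeast LastLeast : ℕ → ℕ → ℕ → Set
FirstLeast a b c = a < b × a < c
LastLeast  a b c = FirstLeast c b a

≤⇒≤punchIn : ∀ (i : Fin (suc n)) j {k} → k ≤ toℕ j → k ≤ toℕ (punchIn i j)
≤⇒≤punchIn i j k≤j with toℕ i ≤? toℕ j
... | yes i≤j = subst (_ ≤_) (sym (toℕ-punchIn-≥ i j i≤j)) (m≤n⇒m≤1+n k≤j)
... | no  i≰j = subst (_ ≤_) (sym (toℕ-punchIn-< i j (≰⇒> i≰j))) k≤j

-- x < `punchIn x v` means x ≤ v; and once x ≤ y, x ≤ `punchIn y z` means x ≤ z.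
ascentCode : BlockCode FirstLeast Ascent
ascentCode = record
  { invariant = λ f mono → mk⇔ (λ (a , b) → to mono a , to mono b) (λ (a , b) → from mono a , from mono b)
  ; bounded = λ (x≤y , _ , y≤1+z) → m≤n⇒m≤1+n x≤y , y≤1+z
  ; decodes = λ x y z (x≤y , x≤z , _) → ≤⇒<punchIn x y x≤y , ≤⇒<punchIn x _ (≤⇒≤punchIn y z x≤z)
  ; encodes = λ x y z _ y≤1+z (x<y′ , x<z′) →
      let x≤y = <punchIn⇒≤ x y x<y′ in x≤y , x≤z x y z x≤y (<punchIn⇒≤ x _ x<z′) , y≤1+z
  }
  where
  x≤z : ∀ (x : Fin (3 + m)) y z → toℕ x ≤ toℕ y → toℕ x ≤ toℕ (punchIn y z) → toℕ x ≤ toℕ z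
  x≤z x y z x≤y x≤z′ with toℕ y ≤? toℕ z
  ... | yes y≤z = ≤-trans x≤y y≤z
  ... | no  y≰z = subst (toℕ x ≤_) (toℕ-punchIn-< y z (≰⇒> y≰z)) x≤z′

-- A least last value means z < y and z < x. With y ≤ z + 1 and x ≤ y + 1 this leaves y = z + 1 and
-- two choices for x.
descentCode : BlockCode LastLeast Descent
descentCode = record
  { invariant = λ f mono → mk⇔ (λ (a , b) → to mono a , to mono b) (λ (a , b) → from mono a , from mono b)
  ; bounded = λ { (refl , inj₁ refl) → n≤1+n _ , ≤-refl ; (refl , inj₂ refl) → ≤-refl , ≤-refl }
  ; decodes = λ x y z (y≡1+z , x∈) →
      let z<y = ≤-reflexive (sym y≡1+z) in
      to (punchIn-strictlyMonotone x) (<⇒punchIn< y z z<y) ,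
      <⇒punchIn< x _ (subst (_< toℕ x) (sym (toℕ-punchIn-< y z z<y)) (z<x x∈))
  ; encodes = λ x y z x≤1+y y≤1+z (z′<y′ , z′<x) →
      let z<y = punchIn<⇒< y z (from (punchIn-strictlyMonotone x) z′<y′)
          z<x = subst (_< toℕ x) (toℕ-punchIn-< y z z<y) (punchIn<⇒< x _ z′<x)
          y≡1+z = ≤-antisym y≤1+z z<y
      in y≡1+z , x≡ z<x (subst (λ k → toℕ x ≤ suc k) y≡1+z x≤1+y)
  }
  where
  z<x : ∀ {x z} → x ≡ suc z ⊎ x ≡ suc (suc z) → z < x
  z<x (inj₁ refl) = ≤-refl
  z<x (inj₂ refl) = n≤1+n _
  x≡ : ∀ {x z} → z < x → x ≤ 2 + z → x ≡ suc z ⊎ x ≡ suc (suc z)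
  x≡ z<x x≤2+z with m≤n⇒m<n∨m≡n x≤2+z
  ... | inj₁ (s≤s x≤1+z) = inj₁ (≤-antisym x≤1+z z<x)
  ... | inj₂ x≡2+z       = inj₂ x≡2+z

-- Reversal and conclusion.

opposite-< : ∀ {i j : Fin n} → toℕ i < toℕ j → toℕ (opposite j) < toℕ (opposite i)
opposite-< {n} {i} {j} i<j =
  subst₂ _<_ (sym (opposite-prop j)) (sym (opposite-prop i)) (∸-monoʳ-< (s<s i<j) (toℕ<n j))

-- `g` is separate from `f` because `opposite` is an involution only up to a propositional equality.
occurs213⇒312∘opposite : ∀ {f g : Fin n → ℕ} → (∀ i → f i ≡ g (opposite i)) → Occurs213 f → Occurs312 g
occurs213⇒312∘opposite f≗ (i , j , k , i<j , j<k , fj<fi , fi<fk) =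
  opposite k , opposite j , opposite i , opposite-< j<k , opposite-< i<j ,
  subst₂ _<_ (f≗ j) (f≗ i) fj<fi , subst₂ _<_ (f≗ i) (f≗ k) fi<fk

occurs312⇒213∘opposite : ∀ (f : Fin n → ℕ) → Occurs312 (f ∘ opposite) → Occurs213 f
occurs312⇒213∘opposite f (i , j , k , i<j , j<k , j<ₚk , k<ₚi) =
  opposite k , opposite j , opposite i , opposite-< j<k , opposite-< i<j , j<ₚk , k<ₚi

-- The length is a multiple of three, so reversal takes block i to block n - 1 - i, and its last
-- position to the first one there.
EveryBlock-opposite : ∀ n (T : ℕ → ℕ → ℕ → Set) (f : Fin (3 * n) → ℕ) → EveryBlock T f →
  EveryBlock (λ a b c → T c b a) (f ∘ opposite)
EveryBlock-opposite n T f bs i p q r p≡ q≡ r≡ =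
  bs (n ∸ suc i) (opposite r) (opposite q) (opposite p) r′≡
    (trans (next r≡1+q) (trans (cong suc r′≡) (+-comm 1 (3 * (n ∸ suc i)))))
    (trans (next q≡1+p) (trans (cong suc (next r≡1+q))
      (trans (cong (2 +_) r′≡) (+-comm 2 (3 * (n ∸ suc i))))))
  where
  q≡1+p : toℕ q ≡ suc (toℕ p)
  q≡1+p = trans q≡ (trans (+-comm _ 1) (cong suc (sym p≡)))
  r≡1+q : toℕ r ≡ suc (toℕ q)
  r≡1+q = trans r≡ (trans (+-comm _ 2) (cong suc (trans (+-comm 1 _) (sym q≡))))
  r′≡ : toℕ (opposite r) ≡ 3 * (n ∸ suc i)
  r′≡ = begin
    toℕ (opposite r)    ≡⟨ opposite-prop r ⟩
    3 * n ∸ suc (toℕ r) ≡⟨ cong (3 * n ∸_) (trans (cong suc (trans r≡ (+-comm _ 2))) (sym (*-suc 3 i))) ⟩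
    3 * n ∸ 3 * suc i   ≡⟨ *-distribˡ-∸ 3 n (suc i) ⟨
    3 * (n ∸ suc i)     ∎
    where open ≡-Reasoning
  next : ∀ {i j : Fin (3 * n)} → toℕ j ≡ suc (toℕ i) → toℕ (opposite i) ≡ suc (toℕ (opposite j))
  next {i} {j} j≡1+i = begin
    toℕ (opposite i)          ≡⟨ opposite-prop i ⟩
    3 * n ∸ suc (toℕ i)       ≡⟨ cong (3 * n ∸_) j≡1+i ⟨
    3 * n ∸ toℕ j             ≡⟨ +-∸-assoc 1 (toℕ<n j) ⟩
    suc (3 * n ∸ suc (toℕ j)) ≡⟨ cong suc (opposite-prop j) ⟨
    suc (toℕ (opposite j))    ∎
    where open ≡-Reasoning

HasCard-312 : ∀ n → HasCard (InS2 n Contains312) (coefB n 1)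
HasCard-312 n = Counting.HasCard-Admissible ascentCode id (λ _ → refl) (HasCard-AscentWord n)

HasCard-213 : ∀ n → HasCard (InS2 n Contains213) (coefB n 1)
HasCard-213 n = HasCard-cong reversal
  (Counting.HasCard-Admissible descentCode opposite opposite-involutive (HasCard-DescentWord n 0))
  where
  open Counting descentCode using (Admissible)
  reversal : ∀ π → Admissible (lookup π ∘ opposite) ⇔ InS2 n Contains213 π
  reversal π = mk⇔
    (λ (inj , avoids , bs) →
      (λ i j eq → trans (sym (opposite-involutive i)) (trans (cong opposite (inj (opposite i) (opposite j)
         (trans (cong (lookup π) (opposite-involutive i))
           (trans eq (cong (lookup π) (sym (opposite-involutive j))))))) (opposite-involutive j))) ,
      avoids ∘ occurs213⇒312∘opposite (λ i → cong (val π) (sym (opposite-involutive i))) ,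
      EveryBlock-cong FirstLeast (cong (val π) ∘ opposite-involutive)
        (EveryBlock-opposite n LastLeast (val π ∘ opposite) bs))
    (λ (inj , avoids , bs) →
      (λ i j eq → trans (sym (opposite-involutive i))
        (trans (cong opposite (inj _ _ eq)) (opposite-involutive j))) ,
      avoids ∘ occurs312⇒213∘opposite (val π) ,
      EveryBlock-opposite n FirstLeast (val π) bs)

theorem13 : (n : ℕ) →
    HasCardFormula (InS2 n Contains213) n × HasCardFormula (InS2 n Contains312) n
theorem13 n =
  (coefB n 1 , HasCard-213 n , coefB-binomSum n) , (coefB n 1 , HasCard-312 n , coefB-binomSum n)
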